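{- Let $G$ be a graph and let $m\in\mathbb N$ with $\operatorname{Z}(G)\le m\le|V(G)|$. Then $$\operatorname{ppt}(G,m)\le\left\lceil\frac{\operatorname{pt}(G,m)}{2}\right\rceil.$$
   Context: All graphs are finite, simple and undirected. Each vertex is blue or white; blue vertices stay blue. Standard zero forcing rule: a blue vertex $u$ with exactly one white neighbor $v$ can force $v$ to become blue. For an initial blue set $B$, put $B^{[0]}=B$ and let $B^{[k]}$ be the union of $B^{[k-1]}$ and the set of all vertices that can be forced by some vertex when exactly $B^{[k-1]}$ is blue. $B$ is a standard zero forcing set if $B^{[k]}=V(G)$ for some $k$, and the least such $k$ is $\operatorname{pt}(G,B)$. $\operatorname{Z}(G)$ is the minimum size of a standard zero forcing set, and $\operatorname{pt}(G,m)$ is the minimum of $\operatorname{pt}(G,B)$ over standard zero forcing sets with $|B|=m$. Power domination: for an initial blue set $B$, put $P^{[0]}=B$, $P^{[1]}=N_G[B]$ (the closed neighborhood of $B$), and for $k\ge2$ let $P^{[k]}$ be the union of $P^{[k-1]}$ and all vertices that can be forced under the standard rule when exactly $P^{[k-1]}$ is blue. $B$ is a power dominating set if $P^{[k]}=V(G)$ for some $k$; the least such $k$ is $\operatorname{ppt}(G,B)$. $\operatorname{ppt}(G,m)$ is the minimum of $\operatorname{ppt}(G,B)$ over power dominating sets $B$ with $|B|=m$. -}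

module Defs where

open import Data.Fin.Base using (Fin)
open import Data.Fin.Subset using (Subset; ∣_∣) renaming (_∈_ to _∈ₛ_)
open import Data.Nat.Base using (ℕ; zero; suc; _≤_)
open import Data.Product.Base using (∃-syntax; _×_)
open import Level using (0ℓ)
open import Relation.Binary.Core using (Rel)
open import Relation.Binary.Definitions using (Decidable; Symmetric; Irreflexive)
open import Relation.Binary.PropositionalEquality.Core using (_≡_)
open import Relation.Unary using (Pred; _∈_; _∉_; _∪_; Universal)

-- Finite simple undirected graphs, up to a labelling of the vertices.
-- Decidability of adjacency is what makes the graph a finite object
-- constructively; classically it is no restriction.
record Graph : Set₁ where
  infix 4 _~_ _~?_
  field
    order  : ℕ
    _~_    : Rel (Fin order) 0ℓ
    _~?_   : Decidable _~_
    sym    : Symmetric _~_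
    irrefl : Irreflexive _≡_ _~_

-- The minima below are relations "k is the minimum of P" rather than functions,
-- since the minimum over an empty set is undefined.
IsLeast : Pred ℕ 0ℓ → Pred ℕ 0ℓ
IsLeast P k = P k × (∀ j → P j → k ≤ j)

module _ (G : Graph) where
  open Graph G

  Vertex : Set
  Vertex = Fin order

  -- CanForce S u v: when exactly S is blue, v is the unique white neighbour
  -- of the blue vertex u.
  CanForce : Pred Vertex 0ℓ → Vertex → Vertex → Set
  CanForce S u v =
    u ∈ S × u ~ v × v ∉ S × (∀ w → u ~ w → w ∉ S → w ≡ v)

  Forced : Pred Vertex 0ℓ → Pred Vertex 0ℓ
  Forced S v = ∃[ u ] CanForce S u v

  ClosedNbhd : Pred Vertex 0ℓ → Pred Vertex 0ℓ
  ClosedNbhd S = S ∪ (λ v → ∃[ u ] (u ∈ S × u ~ v))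

  -- B^[k]
  zfBlue : Subset order → ℕ → Pred Vertex 0ℓ
  zfBlue B zero    = _∈ₛ B
  zfBlue B (suc k) = zfBlue B k ∪ Forced (zfBlue B k)

  -- P^[k]
  pdBlue : Subset order → ℕ → Pred Vertex 0ℓ
  pdBlue B zero          = _∈ₛ B
  pdBlue B (suc zero)    = ClosedNbhd (_∈ₛ B)
  pdBlue B (suc (suc k)) = pdBlue B (suc k) ∪ Forced (pdBlue B (suc k))

  IsZeroForcingSet : Subset order → Set
  IsZeroForcingSet B = ∃[ k ] Universal (zfBlue B k)

  IsPowerDominatingSet : Subset order → Set
  IsPowerDominatingSet B = ∃[ k ] Universal (pdBlue B k)

  -- k = pt(G,B)
  IsPtOf : Subset order → ℕ → Set
  IsPtOf B = IsLeast (λ k → Universal (zfBlue B k))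

  -- k = ppt(G,B)
  IsPptOf : Subset order → ℕ → Set
  IsPptOf B = IsLeast (λ k → Universal (pdBlue B k))

  -- z = Z(G)
  IsZ : ℕ → Set
  IsZ = IsLeast (λ s → ∃[ B ] (IsZeroForcingSet B × ∣ B ∣ ≡ s))

  -- p = pt(G,m)
  IsPt : ℕ → ℕ → Set
  IsPt m = IsLeast (λ k → ∃[ B ] (IsZeroForcingSet B × ∣ B ∣ ≡ m × IsPtOf B k))

  -- q = ppt(G,m)
  IsPpt : ℕ → ℕ → Set
  IsPpt m = IsLeast (λ k → ∃[ B ] (IsPowerDominatingSet B × ∣ B ∣ ≡ m × IsPptOf B k))

{-# OPTIONS --safe #-}

-- Let B force G in p steps along chosen forces, and let S collect the last
-- blue vertex of each forcing chain at time t = ⌊p/2⌋.  A vertex that has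
-- forced by time t has all its neighbours blue by then, so S separates the
-- vertices that have already forced from those that are still white.  Starting
-- from S, power domination can therefore replay the forces after time t in
-- order and the forces up to time t backwards, independently of each other; its
-- first step dominates, so each side needs one step per time unit, at most
-- ⌈p/2⌉ in all.
module Submission where

open import Defs
open import Data.Fin.Base as Fin using (Fin; zero; suc)
import Data.Fin.Properties as Fin
open import Data.Fin.Subset using (Subset; inside; outside; ∣_∣; ⊥; ⊤; ⁅_⁆; _⊆_)
  renaming (_∈_ to _∈ₛ_; _∪_ to _∪ₛ_)
open import Data.Fin.Subset.Properties
  using (_∈?_; anySubset?; ∣⊤∣≡n; ∣⊥∣≡0; ∣⁅x⁆∣≡1; ⊆⊤; s⊆s; out⊆; x∈⁅x⁆; p⊆p∪q; q⊆p∪q)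
open import Data.Nat.Base
  using (ℕ; zero; suc; _+_; _≤_; _<_; _≤′_; ≤′-refl; ≤′-step; z≤n; s≤s; ⌊_/2⌋; ⌈_/2⌉)
import Data.Nat.Properties as ℕ
open import Data.Product.Base using (∃; ∃-syntax; _×_; _,_; proj₁; proj₂)
open import Data.Sum.Base using (_⊎_; inj₁; inj₂; [_,_]′)
open import Data.Vec.Base using ([]; _∷_; here; there)
open import Function.Base using (_∘_)
open import Relation.Binary.Definitions using (tri<; tri≈; tri>)
open import Relation.Binary.PropositionalEquality.Core
  using (_≡_; refl; sym; cong; subst)
open import Relation.Nullary using (¬_; Dec; yes; no; contradiction)
open import Relation.Nullary.Decidable using (_×-dec_; _→-dec_; ¬?)
open import Relation.Unary using (Pred; Decidable; Universal; _∈_; _∪_)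
open import Relation.Unary.Properties using (_∪?_)
open import Level using (0ℓ)

-- Minima, images and supersets of finite sets.

least : ∀ {P : Pred ℕ 0ℓ} → Decidable P → ∀ n → P n → ∃ (IsLeast P)
least {P} P? n Pn with P? 0
... | yes P0 = 0 , P0 , λ _ _ → z≤n
least P? zero    P0 | no ¬P0 = contradiction P0 ¬P0
least {P} P? (suc n) Pn | no ¬P0 with k , Pk , k-min ← least (P? ∘ suc) n Pn =
  suc k , Pk , λ { zero P0 → contradiction P0 ¬P0 ; (suc j) Pj → s≤s (k-min j Pj) }

first : ∀ {n} {P : Pred (Fin n) 0ℓ} → Decidable P → ∃ P →
        ∃[ i ] (P i × (∀ j → P j → i Fin.≤ j))
first {suc n} P? (i , Pi) with P? zero
... | yes P0 = zero , P0 , λ _ _ → z≤n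
first {suc n} P? (zero  , P0) | no ¬P0 = contradiction P0 ¬P0
first {suc n} P? (suc i , Pi) | no ¬P0 with k , Pk , k-min ← first (P? ∘ suc) (i , Pi) =
  suc k , Pk , λ { zero P0 → contradiction P0 ¬P0 ; (suc j) Pj → s≤s (k-min j Pj) }

∣p∪q∣≤∣p∣+∣q∣ : ∀ {n} (p q : Subset n) → ∣ p ∪ₛ q ∣ ≤ ∣ p ∣ + ∣ q ∣
∣p∪q∣≤∣p∣+∣q∣ []            []            = z≤n
∣p∪q∣≤∣p∣+∣q∣ (outside ∷ p) (outside ∷ q) = ∣p∪q∣≤∣p∣+∣q∣ p q
∣p∪q∣≤∣p∣+∣q∣ (outside ∷ p) (inside ∷ q)  =
  ℕ.≤-trans (s≤s (∣p∪q∣≤∣p∣+∣q∣ p q)) (ℕ.≤-reflexive (sym (ℕ.+-suc ∣ p ∣ ∣ q ∣)))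
∣p∪q∣≤∣p∣+∣q∣ (inside ∷ p)  (outside ∷ q) = s≤s (∣p∪q∣≤∣p∣+∣q∣ p q)
∣p∪q∣≤∣p∣+∣q∣ (inside ∷ p)  (inside ∷ q)  =
  s≤s (ℕ.≤-trans (∣p∪q∣≤∣p∣+∣q∣ p q) (ℕ.+-monoʳ-≤ ∣ p ∣ (ℕ.n≤1+n ∣ q ∣)))

image : ∀ {n m} → (Fin n → Fin m) → Subset n → Subset m
image f []            = ⊥
image f (outside ∷ p) = image (f ∘ suc) p
image f (inside  ∷ p) = ⁅ f zero ⁆ ∪ₛ image (f ∘ suc) p

∈-image : ∀ {n m} (f : Fin n → Fin m) {p i} → i ∈ₛ p → f i ∈ₛ image f p
∈-image f {inside  ∷ p} here        = p⊆p∪q _ (x∈⁅x⁆ (f zero))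
∈-image f {outside ∷ p} (there i∈p) = ∈-image (f ∘ suc) i∈p
∈-image f {inside  ∷ p} (there i∈p) = q⊆p∪q _ _ (∈-image (f ∘ suc) i∈p)

∣image∣≤∣p∣ : ∀ {n m} (f : Fin n → Fin m) p → ∣ image f p ∣ ≤ ∣ p ∣
∣image∣≤∣p∣ {m = m} f []  = ℕ.≤-reflexive (∣⊥∣≡0 m)
∣image∣≤∣p∣ f (outside ∷ p) = ∣image∣≤∣p∣ (f ∘ suc) p
∣image∣≤∣p∣ f (inside  ∷ p) = begin
  ∣ ⁅ f zero ⁆ ∪ₛ image (f ∘ suc) p ∣       ≤⟨ ∣p∪q∣≤∣p∣+∣q∣ ⁅ f zero ⁆ _ ⟩
  ∣ ⁅ f zero ⁆ ∣ + ∣ image (f ∘ suc) p ∣    ≡⟨ cong (_+ ∣ image (f ∘ suc) p ∣) (∣⁅x⁆∣≡1 (f zero)) ⟩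
  suc ∣ image (f ∘ suc) p ∣                 ≤⟨ s≤s (∣image∣≤∣p∣ (f ∘ suc) p) ⟩
  suc ∣ p ∣                                 ∎
  where open ℕ.≤-Reasoning

superset : ∀ {n} (p : Subset n) m → ∣ p ∣ ≤ m → m ≤ n → ∃[ q ] (p ⊆ q × ∣ q ∣ ≡ m)
superset [] zero _ _ = [] , (λ ()) , refl
superset {suc n} (outside ∷ p) m ∣p∣≤m m≤1+n with ℕ.m≤n⇒m<n∨m≡n m≤1+n
... | inj₂ refl = ⊤ , ⊆⊤ , ∣⊤∣≡n (suc n)
... | inj₁ (s≤s m≤n) with q , p⊆q , ∣q∣≡m ← superset p m ∣p∣≤m m≤n =
  outside ∷ q , out⊆ p⊆q , ∣q∣≡m
superset (inside ∷ p) (suc m) (s≤s ∣p∣≤m) (s≤s m≤n)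
  with q , p⊆q , ∣q∣≡m ← superset p m ∣p∣≤m m≤n = inside ∷ q , s⊆s p⊆q , cong suc ∣q∣≡m

-- With R B k the universality of the k-th blue set, this covers both IsPt and IsPpt.
minTime : ∀ {n} (R : Subset n → Pred ℕ 0ℓ) → (∀ B → Decidable (R B)) →
          ∀ {m} B k → R B k → ∣ B ∣ ≡ m →
          ∃[ p ] (IsLeast (λ k → ∃[ B ] (∃ (R B) × ∣ B ∣ ≡ m × IsLeast (R B) k)) p × p ≤ k)
minTime R R? {m} B k RBk ∣B∣≡m
  -- One search over times and sets suffices: the least `j` attained by any set of size `m` is also
  -- the least time of the set `A` attaining it.
  with p , (A , ∣A∣≡m , RAp) , p-min ←
    least (λ j → anySubset? (λ B → (∣ B ∣ ℕ.≟ m) ×-dec R? B j)) k (B , ∣B∣≡m , RBk) =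
  p , ( (A , (p , RAp) , ∣A∣≡m , RAp , λ j RAj → p-min j (A , ∣A∣≡m , RAj))
      , λ j (C , _ , ∣C∣≡m , RCj , _) → p-min j (C , ∣C∣≡m , RCj))
    , p-min k (B , ∣B∣≡m , RBk)

-- Blue sets and the choice of forces.

module _ (G : Graph) where
  open Graph G using (order; _~_; _~?_) renaming (sym to ~-sym)

  private
    V : Set
    V = Fin order

  canForce? : ∀ {S} → Decidable S → ∀ u v → Dec (CanForce G S u v)
  canForce? S? u v =
    S? u ×-dec (u ~? v) ×-dec ¬? (S? v) ×-dec
    Fin.all? (λ w → (u ~? w) →-dec (¬? (S? w) →-dec (w Fin.≟ v)))

  forced? : ∀ {S} → Decidable S → Decidable (Forced G S)
  forced? S? v = Fin.any? (λ u → canForce? S? u v)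

  zfBlue? : ∀ B k → Decidable (zfBlue G B k)
  zfBlue? B zero    = _∈? B
  zfBlue? B (suc k) = zfBlue? B k ∪? forced? (zfBlue? B k)

  pdBlue? : ∀ B k → Decidable (pdBlue G B k)
  pdBlue? B zero          = _∈? B
  pdBlue? B (suc zero)    = (_∈? B) ∪? (λ v → Fin.any? (λ u → (u ∈? B) ×-dec (u ~? v)))
  pdBlue? B (suc (suc k)) = pdBlue? B (suc k) ∪? forced? (pdBlue? B (suc k))

  -- The conclusion allows for `v` being blue already, so a replayed force need not have a white
  -- target.
  advance : ∀ {S u v} → Decidable S → u ∈ S → u ~ v →
            (∀ w → u ~ w → w ≡ v ⊎ w ∈ S) → v ∈ S ∪ Forced G S
  advance {S} {u} {v} S? u∈S u~v nbrs with S? v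
  ... | yes v∈S = inj₁ v∈S
  ... | no  v∉S = inj₂ (u , u∈S , u~v , v∉S , λ w u~w w∉S →
                        [ (λ w≡v → w≡v) , (λ w∈S → contradiction w∈S w∉S) ]′ (nbrs w u~w))

  canForce⇒nbrs : ∀ {S u v} → Decidable S → CanForce G S u v →
                  ∀ w → u ~ w → w ≡ v ⊎ w ∈ S
  canForce⇒nbrs S? (_ , _ , _ , unique) w u~w with S? w
  ... | yes w∈S = inj₂ w∈S
  ... | no  w∉S = inj₁ (unique w u~w w∉S)

  -- A force available from `S` stays available from `T`, unless `T` already contains its target.
  ∪-Forced-mono : ∀ {S T : Pred V 0ℓ} → Decidable S → Decidable T →
                  (∀ v → v ∈ S → v ∈ T) → ∀ v → v ∈ S ∪ Forced G S → v ∈ T ∪ Forced G T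
  ∪-Forced-mono S? T? S⊆T v (inj₁ v∈S) = inj₁ (S⊆T v v∈S)
  ∪-Forced-mono S? T? S⊆T v (inj₂ (u , f@(u∈S , u~v , _))) =
    advance T? (S⊆T u u∈S) u~v λ w u~w →
      [ inj₁ , inj₂ ∘ S⊆T w ]′ (canForce⇒nbrs S? f w u~w)

  zfBlue-mono : ∀ {A B} → A ⊆ B → ∀ k v → zfBlue G A k v → zfBlue G B k v
  zfBlue-mono A⊆B zero    v = A⊆B
  zfBlue-mono A⊆B (suc k) =
    ∪-Forced-mono (zfBlue? _ k) (zfBlue? _ k) (zfBlue-mono A⊆B k)

  pdBlue-mono : ∀ {A B} → A ⊆ B → ∀ k v → pdBlue G A k v → pdBlue G B k v
  pdBlue-mono A⊆B zero          v v∈A                    = A⊆B v∈A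
  pdBlue-mono A⊆B (suc zero)    v (inj₁ v∈A)             = inj₁ (A⊆B v∈A)
  pdBlue-mono A⊆B (suc zero)    v (inj₂ (u , u∈A , u~v)) = inj₂ (u , A⊆B u∈A , u~v)
  pdBlue-mono A⊆B (suc (suc k)) =
    ∪-Forced-mono (pdBlue? _ (suc k)) (pdBlue? _ (suc k)) (pdBlue-mono A⊆B (suc k))

  zfBlue-≤ : ∀ {B j k v} → j ≤ k → zfBlue G B j v → zfBlue G B k v
  zfBlue-≤ {B} {v = v} = go ∘ ℕ.≤⇒≤′
    where
    go : ∀ {j k} → j ≤′ k → zfBlue G B j v → zfBlue G B k v
    go ≤′-refl       = λ b → b
    go (≤′-step j≤k) = inj₁ ∘ go j≤k

  ∈⇒pdBlue : ∀ {S v} k → v ∈ₛ S → pdBlue G S k v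
  ∈⇒pdBlue zero          v∈S = v∈S
  ∈⇒pdBlue (suc zero)    v∈S = inj₁ v∈S
  ∈⇒pdBlue (suc (suc k)) v∈S = inj₁ (∈⇒pdBlue (suc k) v∈S)

  nbr⇒pdBlue : ∀ {S u v} k → u ∈ₛ S → u ~ v → pdBlue G S (suc k) v
  nbr⇒pdBlue zero    u∈S u~v = inj₂ (_ , u∈S , u~v)
  nbr⇒pdBlue (suc k) u∈S u~v = inj₁ (nbr⇒pdBlue k u∈S u~v)

  -- The chosen forces: among the vertices able to force v, the smallest one does.
  Fires : Pred V 0ℓ → V → V → Set
  Fires S u v = CanForce G S u v × (∀ x → CanForce G S x v → u Fin.≤ x)

  fires? : ∀ {S} → Decidable S → ∀ u v → Dec (Fires S u v)
  fires? S? u v = canForce? S? u v ×-dec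
                  Fin.all? (λ x → canForce? S? x v →-dec (u Fin.≤? x))

  fires-unique : ∀ {S u x v} → Fires S u v → Fires S x v → u ≡ x
  fires-unique (f , f-min) (g , g-min) = Fin.≤-antisym (f-min _ g) (g-min _ f)

  chosen : ∀ {S v} → Decidable S → Forced G S v → ∃[ u ] Fires S u v
  chosen {v = v} S? = first (λ u → canForce? S? u v)

  step : ∀ {S} → Decidable S → V → V
  step S? u with Fin.any? (fires? S? u)
  ... | yes (v , _) = v
  ... | no  _       = u

  -- From `S`, `u` can force at most one vertex, so the target that the search finds must be `v`.
  step-fires : ∀ {S u v} (S? : Decidable S) → Fires S u v → step S? u ≡ v
  step-fires {u = u} {v} S? f@((_ , _ , _ , unique) , _) with Fin.any? (fires? S? u)
  ... | yes (w , (_ , u~w , w∉S , _) , _) = unique w u~w w∉S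
  ... | no  ¬f                            = contradiction (v , f) ¬f

  step-idle : ∀ {S u} (S? : Decidable S) → ¬ ∃ (Fires S u) → step S? u ≡ u
  step-idle {u = u} S? ¬f with Fin.any? (fires? S? u)
  ... | yes f = contradiction f ¬f
  ... | no  _ = refl

  -- Forcing chains up to a given time.

  module Chains (B : Subset order) where
    Blue : ℕ → Pred V 0ℓ
    Blue = zfBlue G B

    Blue? : ∀ k → Decidable (Blue k)
    Blue? = zfBlue? B

    -- A force made from `Blue j` takes effect at time `j + 1`, hence by time `t` when `j < t`.
    Past : ℕ → Pred V 0ℓ
    Past t u = ∃[ j ] (j < t × ∃[ v ] Fires (Blue j) u v)

    -- The chain ends at time `t`, built as iterated images of `B` so that they cannot outnumber
    -- `B`.
    active : ℕ → Subset order
    active zero    = B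
    active (suc t) = image (step (Blue? t)) (active t)

    ∣active∣≤∣B∣ : ∀ t → ∣ active t ∣ ≤ ∣ B ∣
    ∣active∣≤∣B∣ zero    = ℕ.≤-refl
    ∣active∣≤∣B∣ (suc t) = ℕ.≤-trans (∣image∣≤∣p∣ (step (Blue? t)) (active t)) (∣active∣≤∣B∣ t)

    -- Only the target was still white, and it turns blue in this very step.
    fires⇒nbrs-Blue : ∀ {j u v} → Fires (Blue j) u v → ∀ w → u ~ w → Blue (suc j) w
    fires⇒nbrs-Blue {j} (f , _) w u~w with canForce⇒nbrs (Blue? j) f w u~w
    ... | inj₁ refl = inj₂ (_ , f)
    ... | inj₂ w∈S  = inj₁ w∈S

    past⇒nbrs-Blue : ∀ {t u} → Past t u → ∀ w → u ~ w → Blue t w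
    past⇒nbrs-Blue (j , j<t , v , f) w u~w = zfBlue-≤ j<t (fires⇒nbrs-Blue {j} f w u~w)

    past⇒Blue : ∀ {t u} → Past t u → Blue t u
    past⇒Blue (j , j<t , _ , (b , _) , _) = zfBlue-≤ (ℕ.<⇒≤ j<t) b

    -- Induction on time: an active vertex stays active if idle and becomes past if it fires. A
    -- newly forced vertex is the image of its chosen forcer, which is not past because past
    -- vertices have no white neighbour left.
    blue⇒active⊎past : ∀ t v → Blue t v → v ∈ₛ active t ⊎ Past t v
    blue⇒active⊎past zero    v v∈B = inj₁ v∈B
    blue⇒active⊎past (suc t) v (inj₁ b) with blue⇒active⊎past t v b
    ... | inj₂ (j , j<t , f) = inj₂ (j , ℕ.m<n⇒m<1+n j<t , f)
    ... | inj₁ v∈act with Fin.any? (fires? (Blue? t) v)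
    ...   | yes f = inj₂ (t , ℕ.≤-refl , f)
    ...   | no ¬f = inj₁ (subst (_∈ₛ _) (step-idle (Blue? t) ¬f) (∈-image _ v∈act))
    blue⇒active⊎past (suc t) v (inj₂ forced)
      with u , f@((b , u~v , v∉ , _) , _) ← chosen (Blue? t) forced
      with blue⇒active⊎past t u b
    ... | inj₁ u∈act = inj₁ (subst (_∈ₛ _) (step-fires (Blue? t) f) (∈-image _ u∈act))
    ... | inj₂ past  = contradiction (past⇒nbrs-Blue past v u~v) v∉

    -- Power domination from the chain ends.

    module _ (t : ℕ) where
      PD : ℕ → Pred V 0ℓ
      PD = pdBlue G (active t)

      pdBlue-suc : ∀ k {v} → PD k v → PD (suc k) v
      pdBlue-suc zero    = inj₁
      pdBlue-suc (suc k) = inj₁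

      -- If u turned blue after time t, none of its neighbours is in the past.
      forward-step : ∀ k → (∀ v → Blue (t + k) v → Past t v ⊎ PD k v) →
                     ∀ v → Blue (suc (t + k)) v → Past t v ⊎ PD (suc k) v
      forward-step k ih v (inj₁ b) = [ inj₁ , inj₂ ∘ pdBlue-suc k ]′ (ih v b)
      forward-step k ih v (inj₂ (u , f@(bu , u~v , v∉ , _))) with Blue? t u
      forward-step k ih v (inj₂ (u , f@(bu , u~v , v∉ , _))) | yes bt
        with blue⇒active⊎past t u bt
      -- The first round dominates, so an active `u` reaches `v` whatever its other neighbours are.
      ... | inj₁ u∈act = inj₂ (nbr⇒pdBlue k u∈act u~v)
      ... | inj₂ past  =
        contradiction (zfBlue-≤ (ℕ.m≤m+n t k) (past⇒nbrs-Blue past v u~v)) v∉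
      -- Round one does not force, so `k = 0` is separate: a `u` blue at time `t + 0` cannot have
      -- turned blue after `t`.
      forward-step zero ih v (inj₂ (u , bu , _)) | no u∉ =
        contradiction (subst (λ s → Blue s u) (ℕ.+-identityʳ t) bu) u∉
      forward-step (suc k) ih v (inj₂ (u , f@(bu , u~v , _))) | no u∉ =
        inj₂ (advance (pdBlue? (active t) (suc k)) (not-past u bu (u∉ ∘ past⇒Blue)) u~v nbrs)
        where
        not-past : ∀ w → Blue (t + suc k) w → ¬ Past t w → PD (suc k) w
        not-past w bw ¬past with ih w bw
        ... | inj₁ past = contradiction past ¬past
        ... | inj₂ d    = d

        nbrs : ∀ w → u ~ w → w ≡ v ⊎ PD (suc k) w
        nbrs w u~w with canForce⇒nbrs (Blue? (t + suc k)) f w u~w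
        ... | inj₁ w≡v = inj₁ w≡v
        ... | inj₂ bw  = inj₂ (not-past w bw λ past → u∉ (past⇒nbrs-Blue past u (~-sym u~w)))

      forward : ∀ k v → Blue (t + k) v → Past t v ⊎ PD k v
      forward zero v b with blue⇒active⊎past t v (subst (λ s → Blue s v) (ℕ.+-identityʳ t) b)
      ... | inj₁ v∈act = inj₂ v∈act
      ... | inj₂ past  = inj₁ past
      forward (suc k) v b =
        forward-step k (forward k) v (subst (λ s → Blue s v) (ℕ.+-suc t k) b)

      -- A neighbour z ≠ x of y in the past forced after y turned blue, as
      -- otherwise its target would be y, which x forces; so z is blue already.
      backward : ∀ k j x y → Fires (Blue j) x y → j < t → t ≤ j + k → PD k x
      -- The bound `t ≤ j + k` grants at least `t - j` rounds to undo a force made from `Blue j`.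
      backward zero j x y f j<t t≤j =
        contradiction (subst (t ≤_) (ℕ.+-identityʳ j) t≤j) (ℕ.<⇒≱ j<t)
      backward (suc k) j x y fx@(cx@(_ , x~y , y∉ , _) , _) j<t t≤j+1+k
        with blue⇒active⊎past t y (zfBlue-≤ j<t (inj₂ (x , cx)))
      ... | inj₁ y∈act = nbr⇒pdBlue k y∈act (~-sym x~y)
      -- `retreat` splits `k` further, so it receives the recursive call, at the smaller `k`, as an
      -- argument.
      ... | inj₂ past@(r , r<t , q , fy@((by , _) , _)) = retreat k t≤j+1+k (backward k)
        where
        blue⇒later : ∀ {i} → Blue i y → j < i
        blue⇒later b = ℕ.≰⇒> λ i≤j → y∉ (zfBlue-≤ i≤j b)

        -- Firing strictly after `j` saves one round, which is spent on the force from `y` back to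
        -- `x`.
        later⇒close : ∀ {i} k → t ≤ j + suc (suc k) → j < i → t ≤ i + suc k
        later⇒close k t≤ j<i = ℕ.≤-trans t≤
          (ℕ.≤-trans (ℕ.≤-reflexive (ℕ.+-suc j (suc k))) (ℕ.+-monoˡ-≤ (suc k) j<i))

        retreat : ∀ k → t ≤ j + suc k →
                  (∀ i z w → Fires (Blue i) z w → i < t → t ≤ i + k → PD k z) →
                  PD (suc k) x
        -- With a single round `j = t - 1`, which leaves no `r` with `j < r < t` at which `y` could
        -- have fired.
        retreat zero t≤j+1 _ = contradiction r<t
          (ℕ.≤⇒≯ (ℕ.≤-trans t≤j+1 (ℕ.≤-trans (ℕ.≤-reflexive (ℕ.+-comm j 1)) (blue⇒later by))))
        retreat (suc k) t≤ ih =
          advance (pdBlue? (active t) (suc k))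
            (ih r y q fy r<t (later⇒close k t≤ (blue⇒later by)))
            (~-sym x~y) nbrs
          where
          nbrs : ∀ z → y ~ z → z ≡ x ⊎ PD (suc k) z
          nbrs z y~z with blue⇒active⊎past t z (past⇒nbrs-Blue past z y~z)
          ... | inj₁ z∈act = inj₂ (∈⇒pdBlue (suc k) z∈act)
          ... | inj₂ (i , i<t , w , fz@(cz , _))
            with canForce⇒nbrs (Blue? i) cz y (~-sym y~z)
          ...   | inj₂ b = inj₂ (ih i z w fz i<t (later⇒close k t≤ (blue⇒later b)))
          -- Both `z` and `x` fire at `y`. Unequal times would make `y` blue before the later force;
          -- at equal times the choice of the smallest forcer gives `z ≡ x`.
          ...   | inj₁ refl with ℕ.<-cmp i j
          ...     | tri< i<j _ _ = contradiction (zfBlue-≤ i<j (inj₂ (z , cz))) y∉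
          ...     | tri≈ _ refl _ = inj₁ (fires-unique fz fx)
          ...     | tri> _ _ j<i =
            contradiction (zfBlue-≤ j<i (inj₂ (x , cx))) (proj₁ (proj₂ (proj₂ cz)))

    -- The forward replay misses only past vertices, and undoing any of their forces takes at most
    -- `t` rounds, hence at most `k`.
    powerDominates : ∀ {t k} → t ≤ k → Universal (Blue (t + k)) →
                     Universal (pdBlue G (active t) k)
    powerDominates {t} {k} t≤k all v with forward t k v (all v)
    ... | inj₂ d = d
    ... | inj₁ (j , j<t , w , f) =
      backward t k j v w f j<t (ℕ.≤-trans t≤k (ℕ.m≤n+m k j))

theorem4p14 : (G : Graph) (m z : ℕ) → IsZ G z → z ≤ m → m ≤ Graph.order G →
    ∃[ p ] ∃[ q ] (IsPt G m p × IsPpt G m q × q ≤ ⌈ p /2⌉)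
theorem4p14 G m z ((A , (k , A-forces) , refl) , _) ∣A∣≤m m≤n
  -- Padding a minimum zero forcing set to size `m` only shows that `pt(G,m)` exists; the chains are
  -- those of an optimal `C`.
  with B , A⊆B , ∣B∣≡m ← superset A m ∣A∣≤m m≤n
  with p , isPt@((C , _ , ∣C∣≡m , C-forces , _) , _) , _ ←
    minTime (λ B k → Universal (zfBlue G B k)) (λ B k → Fin.all? (zfBlue? G B k))
      B k (λ v → zfBlue-mono G A⊆B k v (A-forces v)) ∣B∣≡m
  -- The chain ends are known to number at most `m`; padding them to exactly `m` keeps every vertex
  -- blue in time by monotonicity.
  with S , active⊆S , ∣S∣≡m ←
    superset (Chains.active G C ⌊ p /2⌋) m
      (subst (_ ≤_) ∣C∣≡m (Chains.∣active∣≤∣B∣ G C ⌊ p /2⌋)) m≤n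
  with q , isPpt , q≤⌈p/2⌉ ←
    minTime (λ B k → Universal (pdBlue G B k)) (λ B k → Fin.all? (pdBlue? G B k))
      S ⌈ p /2⌉
      (λ v → pdBlue-mono G active⊆S ⌈ p /2⌉ v
        (Chains.powerDominates G C (ℕ.⌊n/2⌋≤⌈n/2⌉ p)
          (subst (λ s → Universal (zfBlue G C s)) (sym (ℕ.⌊n/2⌋+⌈n/2⌉≡n p)) C-forces) v))
      ∣S∣≡m
  = p , q , isPt , isPpt , q≤⌈p/2⌉
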